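{- Let $G=(V,E)$ be a finite simple undirected graph and let $\kappa$ be a positive integer. Then: (a) for all $(i,j)\in A$, $w_{ij}\ge 0$ defines a facet of $P_{G,\kappa}$; (b) for all $(i,j)\in A$, $w_{ij}\le 1$ is not a facet-defining inequality for $P_{G,\kappa}$; (c) the inequality $z\ge 0$ is not a facet-defining inequality for $P_{G,\kappa}$; (d) the inequality $z\le\kappa$ defines a facet of $P_{G,\kappa}$.
   Context: Let $m=|E|$. Let $D=(V,A)$ be the directed graph with $A=\{(i,j),(j,i)\mid [i,j]\in E\}$. Paths are directed and elementary (no repeated vertices); paths and cycles are identified with their arc sets. $P_\kappa(A)$ denotes the set of all paths in $D$ with exactly $\kappa$ arcs, and $C(A)$ the set of all directed (elementary) cycles in $D$ (including those of length 2), with $|C|$ the number of arcs of $C$. The polytope $P_{G,\kappa}$ is the convex hull of all $(w,z)\in\mathbb{R}^{2m}\times\mathbb{R}$, $w=(w_{ij})_{(i,j)\in A}$, satisfying (1) $w_{ij}+w_{ji}\le 1$ for all $[i,j]\in E$; (2) $\sum_{(i,j)\in C}w_{ij}\le |C|-1$ for all $C\in C(A)$; (3) $\sum_{(i,j)\in p}w_{ij}\le z$ for all $p\in P_\kappa(A)$; (4) $w_{ij}\in\{0,1\}$ for all $(i,j)\in A$; (5) $0\le z\le\kappa$. An inequality defines a facet of $P_{G,\kappa}$ if it is valid for $P_{G,\kappa}$ and the set of points of $P_{G,\kappa}$ satisfying it with equality has dimension $\dim(P_{G,\kappa})-1$.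
   Formalization: Part (c) is stated only when D has a path with exactly κ arcs; otherwise (c) fails: e.g. for E = ∅ the polytope is [0, κ], and z ≥ 0 defines the facet {0}. -}

module Defs where

open import Level using (Level; _⊔_) renaming (suc to lsuc)
open import Algebra.Apartness.Bundles using (HeytingField; HeytingCommutativeRing)
open import Algebra.Bundles using (CommutativeRing)
import Algebra.Definitions.RawMonoid as RawMonoidOps
open import Data.Bool.Base using (Bool; false; T)
open import Data.Fin.Base using (Fin; inject₁; fromℕ) renaming (zero to fzero; suc to fsuc)
open import Data.Integer.Base using (ℤ; +_) renaming (_-_ to _-ℤ_)
open import Data.Nat.Base using (ℕ; suc) renaming (_≤_ to _≤ℕ_)
open import Data.Product.Base using (Σ; ∃; _×_; _,_; proj₁; proj₂)
open import Data.Sum.Base using (_⊎_)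
open import Function.Definitions using (Injective)
open import Relation.Binary.Core using (Rel)
open import Relation.Binary.Structures using (IsStrictPartialOrder)
open import Relation.Binary.PropositionalEquality using (_≡_; subst)
open import Relation.Nullary.Negation.Core using (¬_)
open import Relation.Unary using (Pred; _∈_)

-- The library has no real numbers; an arbitrary ordered field stands in for ℝ.
-- The axioms hold for ℝ both classically and constructively (where the order
-- is neither total nor decidable), which is why ≤ is defined as the negation
-- of the converse strict order.  Classically these are exactly the totally
-- ordered fields.
record OrderedField (c ℓ₁ ℓ₂ ℓ₃ : Level) : Set (lsuc (c ⊔ ℓ₁ ⊔ ℓ₂ ⊔ ℓ₃)) where
  infix 4 _<_ _≤_
  field
    heytingField : HeytingField c ℓ₁ ℓ₂

  open HeytingField heytingField public

  field
    _<_                  : Rel Carrier ℓ₃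
    isStrictPartialOrder : IsStrictPartialOrder _≈_ _<_
    #⇒<⊎>                : ∀ {x y} → x # y → x < y ⊎ y < x
    <⇒#                  : ∀ {x y} → x < y → x # y
    +-monoˡ-<            : ∀ {x y} z → x < y → x + z < y + z
    *-pos                : ∀ {x y} → 0# < x → 0# < y → 0# < x * y

  _≤_ : Rel Carrier ℓ₃
  x ≤ y = ¬ (y < x)

  open CommutativeRing (HeytingCommutativeRing.commutativeRing heytingCommutativeRing) public
    using (+-rawMonoid)

  open RawMonoidOps +-rawMonoid public using (sum) renaming (_×_ to _·_)

  fromNat : ℕ → Carrier
  fromNat k = k · 1#

record SimpleGraph : Set where
  field
    order      : ℕ
    adj        : Fin order → Fin order → Bool
    adj-sym    : ∀ i j → adj i j ≡ adj j i
    adj-irrefl : ∀ i → adj i i ≡ false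

  Vertex : Set
  Vertex = Fin order

  Adj : Vertex → Vertex → Set
  Adj i j = T (adj i j)

-- The bidirected graph D = (V , A) of a simple graph.
module Digraph (G : SimpleGraph) where
  open SimpleGraph G public

  record Arc : Set where
    constructor arc
    field
      src       : Vertex
      tgt       : Vertex
      .adjacent : Adj src tgt

  reverse : Arc → Arc
  reverse (arc i j ij) = arc j i (subst T (adj-sym i j) ij)

  record Path (k : ℕ) : Set where
    field
      vertex     : Fin (suc k) → Vertex
      elementary : Injective _≡_ _≡_ vertex
      adjacent   : ∀ (t : Fin k) → Adj (vertex (inject₁ t)) (vertex (fsuc t))

    arcs : Fin k → Arc
    arcs t = arc (vertex (inject₁ t)) (vertex (fsuc t)) (adjacent t)

  -- An elementary cycle: an elementary path together with an arc from its last
  -- vertex back to its first.  As there are no loops, it has at least two arcs.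
  record Cycle : Set where
    field
      pathLength : ℕ
      path       : Path pathLength
    open Path path public using (vertex; arcs)
    field
      closing : Adj (vertex (fromℕ pathLength)) (vertex fzero)

    closingArc : Arc
    closingArc = arc (vertex (fromℕ pathLength)) (vertex fzero) closing

    length : ℕ
    length = suc pathLength

module Polytope {c ℓ₁ ℓ₂ ℓ₃} (K : OrderedField c ℓ₁ ℓ₂ ℓ₃)
                (G : SimpleGraph) (κ : ℕ) where
  open OrderedField K public
    using (Carrier; _≈_; _≤_; _+_; _-_; _*_; 0#; 1#; sum; fromNat)
  open Digraph G public

  -- ℝ^A × ℝ, with points compared coordinatewise.
  Point : Set c
  Point = (Arc → Carrier) × Carrier

  infix 4 _≋_
  _≋_ : Rel Point ℓ₁
  (w , z) ≋ (w′ , z′) = (∀ a → w a ≈ w′ a) × z ≈ z′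

  origin : Point
  origin = (λ _ → 0#) , 0#

  combination : ∀ {k} → (Fin k → Carrier) → (Fin k → Point) → Point
  combination μ p =
    (λ a → sum (λ t → μ t * proj₁ (p t) a)) , sum (λ t → μ t * proj₂ (p t))

  ConvexHull : ∀ {ℓ} → Pred Point ℓ → Pred Point (c ⊔ ℓ₁ ⊔ ℓ₃ ⊔ ℓ)
  ConvexHull S x =
    ∃ λ k → Σ (Fin k → Carrier) λ μ → Σ (Fin k → Point) λ p →
      (∀ t → p t ∈ S) × (∀ t → 0# ≤ μ t) × sum μ ≈ 1# × x ≋ combination μ p

  AffinelyIndependent : ∀ {k} → (Fin k → Point) → Set (c ⊔ ℓ₁)
  AffinelyIndependent {k} p =
    ∀ (μ : Fin k → Carrier) → sum μ ≈ 0# → combination μ p ≋ origin → ∀ t → μ t ≈ 0#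

  -- The dimension of S is one less than the maximal number of affinely
  -- independent points of S; in particular the empty set has dimension -1.
  HasDimension : ∀ {ℓ} → Pred Point ℓ → ℤ → Set (c ⊔ ℓ₁ ⊔ ℓ)
  HasDimension S d =
    ∃ λ r → d ≡ (+ r) -ℤ (+ 1)
      × (Σ (Fin r → Point) λ p → (∀ t → p t ∈ S) × AffinelyIndependent p)
      × (∀ {s} (p : Fin s → Point) → (∀ t → p t ∈ S) → AffinelyIndependent p → s ≤ℕ r)

  record Feasible (x : Point) : Set (c ⊔ ℓ₁ ⊔ ℓ₃) where
    w : Arc → Carrier
    w = proj₁ x
    z : Carrier
    z = proj₂ x
    field
      edge   : ∀ (a : Arc) → w a + w (reverse a) ≤ 1#
      cycle  : ∀ (C : Cycle) → let open Cycle C in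
                 sum (λ t → w (arcs t)) + w closingArc ≤ fromNat length - 1#
      path   : ∀ (p : Path κ) → sum (λ t → w (Path.arcs p t)) ≤ z
      binary : ∀ (a : Arc) → w a ≈ 0# ⊎ w a ≈ 1#
      z≥0    : 0# ≤ z
      z≤κ    : z ≤ fromNat κ

  P : Pred Point (c ⊔ ℓ₁ ⊔ ℓ₃)
  P = ConvexHull Feasible

  -- The inequality  lhs x ≤ rhs x  in the variable point x.
  record DefinesFacet (lhs rhs : Point → Carrier) : Set (c ⊔ ℓ₁ ⊔ ℓ₃) where
    Face : Pred Point (c ⊔ ℓ₁ ⊔ ℓ₃)
    Face x = x ∈ P × lhs x ≈ rhs x
    field
      valid       : ∀ x → x ∈ P → lhs x ≤ rhs x
      codimension : ∃ λ d → HasDimension P d × HasDimension Face (d -ℤ (+ 1))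

{-# OPTIONS --safe #-}

-- With m arcs, P has the m + 2 affinely independent points (0, 0), (0, κ) and (e_a, κ)
-- for the arcs a, hence is full-dimensional.  All but one of them lie on the
-- face w_a = 0, and likewise on the face z = κ, which gives (a) and (d).  For
-- (b) and (c) two coordinates are constant on the face: w_a = 1 forces
-- w_{reverse a} = 0 by (1), and z = 0 forces w_a = 0 on a path with κ arcs by
-- (3).  Upper bounds on the number of affinely independent points are negative
-- statements, so Gaussian elimination may use pivots that exist only up to
-- double negation.
module Submission where

open import Defs
open import Algebra.Apartness.Bundles using (HeytingCommutativeRing)
open import Algebra.Bundles using (CommutativeRing)
import Algebra.Apartness.Properties.HeytingCommutativeRing as HeytingProperties
import Algebra.Properties.Ring as RingProperties
import Algebra.Properties.Semiring.Sum as SumProperties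
open import Data.Bool.Base using (T; if_then_else_)
open import Data.Empty using (⊥-elim; ⊥-elim-irr)
open import Data.Fin.Base using (Fin; zero; suc; fromℕ<; punchIn; punchOut)
open import Data.Fin.Properties
  using (_≟_; punchIn-punchOut; punchInᵢ≢i; suc-injective)
open import Data.Integer.Base as ℤ using (+_)
import Data.Integer.Properties as ℤ
open import Algebra.Properties.AbelianGroup ℤ.+-0-abelianGroup
  using () renaming (∙-cancelʳ to ℤ-+-cancelʳ)
open import Data.List.Base
  using (List; []; _∷_; lookup; length; concatMap; allFin; cartesianProduct; deduplicate)
open import Data.List.Membership.Propositional using (_∈_; lose)
open import Data.List.Membership.Propositional.Properties
  using (∈-allFin; ∈-cartesianProduct⁺; ∈-concatMap⁺; ∈-deduplicate⁺; ∈-lookup)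
import Data.List.Relation.Unary.All as All
open import Data.List.Relation.Unary.AllPairs using (_∷_)
open import Data.List.Relation.Unary.Any using (here; index)
open import Data.List.Relation.Unary.Any.Properties using (lookup-index)
open import Data.List.Relation.Unary.Unique.Propositional using (Unique)
import Data.List.Relation.Unary.Unique.DecPropositional.Properties as Unique
open import Data.Nat.Base as ℕ using (ℕ; NonZero; zero; suc; s≤s)
import Data.Nat.Properties as ℕ
open import Data.Product.Base using (Σ; ∃; _×_; _,_; proj₁; proj₂)
open import Data.Sum.Base using (_⊎_; inj₁; inj₂; [_,_]′)
open import Data.Vec.Functional using (insertAt)
open import Data.Vec.Functional.Properties using (insertAt-lookup; insertAt-punchIn)
open import Function.Base using (_∘_; id)
import Level
open import Relation.Binary.Definitions using (DecidableEquality)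
open import Relation.Binary.PropositionalEquality as ≡ using (_≡_; _≢_)
import Relation.Binary.Reasoning.Setoid as SetoidReasoning
open import Relation.Binary.Structures using (IsStrictPartialOrder)
open import Relation.Nullary.Decidable
  using (yes; no; does; T?; map′; _×-dec_; decidable-stable; dec-true; dec-false)
open import Relation.Nullary.Negation.Core using (¬_; contradiction)

-- Order and arithmetic in an ordered field without decidable order.

module OrderedFieldProperties {c ℓ₁ ℓ₂ ℓ₃} (K : OrderedField c ℓ₁ ℓ₂ ℓ₃) where
  open OrderedField K hiding (zero)
  open IsStrictPartialOrder isStrictPartialOrder public
    using (irrefl; asym; <-respˡ-≈; <-respʳ-≈)
  open CommutativeRing (HeytingCommutativeRing.commutativeRing heytingCommutativeRing) public
    using (ring; semiring)
  open HeytingProperties heytingCommutativeRing public using (1#0; x-0≈x)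
  open RingProperties ring public using (-1*x≈-x; -‿involutive; -‿distribˡ-*)
  open SumProperties semiring public
    using (sum-cong-≋; sum-remove; ∑-distrib-+; *-distribˡ-sum; *-distribʳ-sum)
  open SetoidReasoning setoid public

  ≤-reflexive : ∀ {x y} → x ≈ y → x ≤ y
  ≤-reflexive x≈y y<x = irrefl (sym x≈y) y<x

  -- Stands in for totality. Apartness splits at `z`; when `z` falls on the wrong side of one
  -- endpoint, transitivity through that endpoint places it on the right side of the other.
  <-cotrans : ∀ {x y} → x < y → ∀ z → x < z ⊎ z < y
  <-cotrans x<y z with #-cotrans (<⇒# x<y) z
  ... | inj₁ x#z with #⇒<⊎> x#z
  ...   | inj₁ x<z = inj₁ x<z
  ...   | inj₂ z<x = inj₂ (IsStrictPartialOrder.trans isStrictPartialOrder z<x x<y)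
  <-cotrans x<y z | inj₂ z#y with #⇒<⊎> z#y
  ...   | inj₁ z<y = inj₂ z<y
  ...   | inj₂ y<z = inj₁ (IsStrictPartialOrder.trans isStrictPartialOrder x<y y<z)

  <-≤-trans : ∀ {x y z} → x < y → y ≤ z → x < z
  <-≤-trans {z = z} x<y y≤z = [ id , ⊥-elim ∘ y≤z ]′ (<-cotrans x<y z)

  ≤-trans : ∀ {x y z} → x ≤ y → y ≤ z → x ≤ z
  ≤-trans {y = y} x≤y y≤z z<x = [ y≤z , x≤y ]′ (<-cotrans z<x y)

  ≤-antisym : ∀ {x y} → x ≤ y → y ≤ x → x ≈ y
  ≤-antisym x≤y y≤x = proj₁ (tight _ _) ([ y≤x , x≤y ]′ ∘ #⇒<⊎>)

  ≤-resp-≈ : ∀ {x x′ y y′} → x ≈ x′ → y ≈ y′ → x ≤ y → x′ ≤ y′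
  ≤-resp-≈ x≈x′ y≈y′ x≤y =
    ≤-trans (≤-reflexive (sym x≈x′)) (≤-trans x≤y (≤-reflexive y≈y′))

  x+y-y≈x : ∀ x y → (x + y) + - y ≈ x
  x+y-y≈x x y = trans (+-assoc x y (- y)) (trans (+-congˡ (-‿inverseʳ y)) (+-identityʳ x))

  +-cancelʳ-< : ∀ {x y} z → x + z < y + z → x < y
  +-cancelʳ-< {x} {y} z lt =
    <-respʳ-≈ (x+y-y≈x y z) (<-respˡ-≈ (x+y-y≈x x z) (+-monoˡ-< (- z) lt))

  -- A violation `y + v < x + u` is split at `x + v`; each half, after cancellation, contradicts one
  -- hypothesis.
  +-mono-≤ : ∀ {x y u v} → x ≤ y → u ≤ v → x + u ≤ y + v
  +-mono-≤ {x} {y} {u} {v} x≤y u≤v lt with <-cotrans lt (x + v)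
  ... | inj₁ y+v<x+v = x≤y (+-cancelʳ-< v y+v<x+v)
  ... | inj₂ x+v<x+u =
    u≤v (+-cancelʳ-< x (<-respˡ-≈ (+-comm x v) (<-respʳ-≈ (+-comm x u) x+v<x+u)))

  *-monoˡ-< : ∀ {c x y} → 0# < c → x < y → c * x < c * y
  *-monoˡ-< {c} {x} {y} 0<c x<y =
    <-respˡ-≈ (+-identityˡ _) (<-respʳ-≈ split (+-monoˡ-< (c * x) (*-pos 0<c 0<y-x)))
    where
    0<y-x : 0# < y + - x
    0<y-x = <-respˡ-≈ (-‿inverseʳ x) (+-monoˡ-< (- x) x<y)
    split : c * (y + - x) + c * x ≈ c * y
    split = begin
      c * (y + - x) + c * x ≈⟨ distribˡ c (y + - x) x ⟨
      c * (y + - x + x)     ≈⟨ *-congˡ (+-assoc y (- x) x) ⟩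
      c * (y + (- x + x))   ≈⟨ *-congˡ (+-congˡ (-‿inverseˡ x)) ⟩
      c * (y + 0#)          ≈⟨ *-congˡ (+-identityʳ y) ⟩
      c * y                 ∎

  -- The sign of `c` cannot be decided, so a violation is assumed. Then `0# < c` is impossible, as
  -- it would exclude `x < y` and hence force `x ≈ y`. So `c ≈ 0#`, and both products vanish.
  *-monoˡ-≤ : ∀ {c x y} → 0# ≤ c → x ≤ y → c * x ≤ c * y
  *-monoˡ-≤ {c} {x} {y} 0≤c x≤y cy<cx = irrefl cy≈cx cy<cx
    where
    c≤0 : c ≤ 0#
    c≤0 0<c = irrefl (*-congˡ (sym x≈y)) cy<cx
      where
      x≈y : x ≈ y
      x≈y = ≤-antisym x≤y λ x<y → asym cy<cx (*-monoˡ-< 0<c x<y)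
    c≈0 : c ≈ 0#
    c≈0 = ≤-antisym c≤0 0≤c
    cy≈cx : c * y ≈ c * x
    cy≈cx = begin
      c * y  ≈⟨ *-congʳ c≈0 ⟩
      0# * y ≈⟨ zeroˡ y ⟩
      0#     ≈⟨ zeroˡ x ⟨
      0# * x ≈⟨ *-congʳ c≈0 ⟨
      c * x  ∎

  0<1 : 0# < 1#
  0<1 with #⇒<⊎> 1#0
  ... | inj₂ 0<1 = 0<1
  -- Here too the goal follows: `- 1#` would be positive, and its square is `1#`.
  ... | inj₁ 1<0 = <-respʳ-≈ (trans (-1*x≈-x (- 1#)) (-‿involutive 1#)) (*-pos 0<-1 0<-1)
    where
    0<-1 : 0# < - 1#
    0<-1 = <-respˡ-≈ (-‿inverseʳ 1#) (<-respʳ-≈ (+-identityˡ (- 1#)) (+-monoˡ-< (- 1#) 1<0))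

  0≤1 : 0# ≤ 1#
  0≤1 = asym 0<1

  0≤fromNat : ∀ n → 0# ≤ fromNat n
  0≤fromNat zero    = ≤-reflexive refl
  0≤fromNat (suc n) = ≤-resp-≈ (+-identityˡ 0#) refl (+-mono-≤ 0≤1 (0≤fromNat n))

  fromNat#0 : ∀ n .{{_ : NonZero n}} → fromNat n # 0#
  fromNat#0 (suc n) = #-sym (<⇒# (<-≤-trans 0<1
    (≤-resp-≈ (+-identityʳ 1#) refl (+-mono-≤ (≤-reflexive refl) (0≤fromNat n)))))

  leftInverse : ∀ {x} → x # 0# → ∃ λ y → y * x ≈ 1#
  leftInverse {x} x#0 with #⇒invertible x#0
  -- The inverse supplied is that of the difference `x - 0#`.
  ... | y , yx≈1 , _ = y , trans (*-congˡ (sym (x-0≈x x))) yx≈1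

  *-zero-cancelʳ : ∀ {x y} → y # 0# → x * y ≈ 0# → x ≈ 0#
  *-zero-cancelʳ {x} {y} y#0 xy≈0 with leftInverse y#0
  ... | v , vy≈1 = begin
    x           ≈⟨ *-identityʳ x ⟨
    x * 1#      ≈⟨ *-congˡ vy≈1 ⟨
    x * (v * y) ≈⟨ *-congˡ (*-comm v y) ⟩
    x * (y * v) ≈⟨ *-assoc x y v ⟨
    x * y * v   ≈⟨ *-congʳ xy≈0 ⟩
    0# * v      ≈⟨ zeroˡ v ⟩
    0#          ∎

  -- Finite sums.

  sum-zero : ∀ {n} {f : Fin n → Carrier} → (∀ i → f i ≈ 0#) → sum f ≈ 0#
  sum-zero {zero}  f≈0 = refl
  sum-zero {suc n} f≈0 = trans (+-cong (f≈0 zero) (sum-zero (f≈0 ∘ suc))) (+-identityˡ 0#)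

  sum-single : ∀ {n} (f : Fin n → Carrier) i → (∀ j → j ≢ i → f j ≈ 0#) → sum f ≈ f i
  sum-single {suc n} f i f≈0 = begin
    sum f                       ≈⟨ sum-remove {i = i} f ⟩
    f i + sum (f ∘ punchIn i)   ≈⟨ +-congˡ (sum-zero λ j → f≈0 (punchIn i j) (punchInᵢ≢i i j)) ⟩
    f i + 0#                    ≈⟨ +-identityʳ (f i) ⟩
    f i                         ∎

  sum-mono-≤ : ∀ {n} {f g : Fin n → Carrier} → (∀ i → f i ≤ g i) → sum f ≤ sum g
  sum-mono-≤ {zero}  f≤g = ≤-reflexive refl
  sum-mono-≤ {suc n} f≤g = +-mono-≤ (f≤g zero) (sum-mono-≤ (f≤g ∘ suc))

  sum-≤-fromNat : ∀ {n} {f : Fin n → Carrier} → (∀ i → f i ≤ 1#) → sum f ≤ fromNat n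
  sum-≤-fromNat {zero}  f≤1 = ≤-reflexive refl
  sum-≤-fromNat {suc n} f≤1 = +-mono-≤ (f≤1 zero) (sum-≤-fromNat (f≤1 ∘ suc))

  sum-weighted-const : ∀ {n} (μ : Fin n → Carrier) {f : Fin n → Carrier} {c} →
                       (∀ t → f t ≈ c) → sum (λ t → μ t * f t) ≈ sum μ * c
  sum-weighted-const μ {f} {c} f≈c =
    trans (sum-cong-≋ λ t → *-congˡ (f≈c t)) (sym (*-distribʳ-sum c μ))

  sum-insertAt : ∀ {n} (ν : Fin n → Carrier) i v (f : Fin (suc n) → Carrier) →
                 sum (λ t → insertAt ν i v t * f t)
                   ≈ v * f i + sum (λ j → ν j * f (punchIn i j))
  sum-insertAt ν i v f = trans (sum-remove {i = i} (λ t → insertAt ν i v t * f t))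
    (+-cong (*-congʳ (reflexive (insertAt-lookup ν i v)))
            (sum-cong-≋ λ j → *-congʳ (reflexive (insertAt-punchIn ν i v j))))

  -- Gaussian elimination.

  -- Induction on the number of equations. An entry of the first row apart from zero would serve as
  -- a pivot and reduce the system by one equation and one unknown, which the induction hypothesis
  -- refutes. So no entry is apart from zero, the first row vanishes by tightness, and the remaining
  -- rows again contradict the induction hypothesis.
  kernel-nontrivial :
    ∀ {n s} → n ℕ.< s → (A : Fin n → Fin s → Carrier) →
    ¬ (∀ (μ : Fin s → Carrier) →
       (∀ i → sum (λ t → μ t * A i t) ≈ 0#) → ∀ t → μ t ≈ 0#)
  kernel-nontrivial {zero} {suc s} _ A trivial =
    proj₂ (tight _ _) (trivial (λ _ → 1#) (λ ()) zero) 1#0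
  kernel-nontrivial {suc n} {suc s} (s≤s n<s) A trivial =
    kernel-nontrivial (ℕ.m<n⇒m<1+n n<s) (A ∘ suc) λ μ μA≈0 → trivial μ λ where
      zero    → sum-zero λ t → trans (*-congˡ (no-pivot t)) (zeroʳ (μ t))
      (suc i) → μA≈0 i
    where
    module Pivot (p : Fin (suc s)) (u : Carrier) (uAp≈1 : u * A zero p ≈ 1#) where
      d : Fin n → Carrier
      d i = - (u * A (suc i) p)

      -- The Schur complement of the pivot: adding `d i` times the first row clears column `p`,
      -- which is then dropped.
      B : Fin n → Fin s → Carrier
      B i j = A (suc i) (punchIn p j) + d i * A zero (punchIn p j)

      module _ (ν : Fin s → Carrier) (νB≈0 : ∀ i → sum (λ j → ν j * B i j) ≈ 0#) where
        S : Carrier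
        S = sum (λ j → ν j * A zero (punchIn p j))

        -- The entry at `p` is the first equation solved for that unknown.
        lift : Fin (suc s) → Carrier
        lift = insertAt ν p (- (u * S))

        -- Serves all rows: the pivot entry turns the coefficient of `S` into `- 1#`, and an entry
        -- below it gives `d i`.
        head-coefficient : ∀ x → - (u * S) * x ≈ - (u * x) * S
        head-coefficient x = begin
          - (u * S) * x   ≈⟨ -‿distribˡ-* (u * S) x ⟨
          - (u * S * x)   ≈⟨ -‿cong (*-assoc u S x) ⟩
          - (u * (S * x)) ≈⟨ -‿cong (*-congˡ (*-comm S x)) ⟩
          - (u * (x * S)) ≈⟨ -‿cong (*-assoc u x S) ⟨
          - (u * x * S)   ≈⟨ -‿distribˡ-* (u * x) S ⟩
          - (u * x) * S   ∎

        lift-kills : ∀ i → sum (λ t → lift t * A i t) ≈ 0#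
        lift-kills zero = begin
          sum (λ t → lift t * A zero t) ≈⟨ sum-insertAt ν p (- (u * S)) (A zero) ⟩
          - (u * S) * A zero p + S      ≈⟨ +-congʳ (head-coefficient (A zero p)) ⟩
          - (u * A zero p) * S + S      ≈⟨ +-congʳ (*-congʳ (-‿cong uAp≈1)) ⟩
          - 1# * S + S                  ≈⟨ +-congʳ (-1*x≈-x S) ⟩
          - S + S                       ≈⟨ -‿inverseˡ S ⟩
          0#                            ∎
        lift-kills (suc i) = begin
          sum (λ t → lift t * A (suc i) t)
            ≈⟨ sum-insertAt ν p (- (u * S)) (A (suc i)) ⟩
          - (u * S) * A (suc i) p + R
            ≈⟨ +-congʳ (head-coefficient (A (suc i) p)) ⟩
          d i * S + R
            ≈⟨ +-comm (d i * S) R ⟩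
          R + d i * S
            ≈⟨ +-congˡ (*-distribˡ-sum (d i) (λ j → ν j * A zero (punchIn p j))) ⟩
          R + sum (λ j → d i * (ν j * A zero (punchIn p j)))
            ≈⟨ ∑-distrib-+ (λ j → ν j * A (suc i) (punchIn p j)) _ ⟨
          sum (λ j → ν j * A (suc i) (punchIn p j) + d i * (ν j * A zero (punchIn p j)))
            ≈⟨ sum-cong-≋ (λ j → +-congˡ (swap (d i) (ν j) (A zero (punchIn p j)))) ⟩
          sum (λ j → ν j * A (suc i) (punchIn p j) + ν j * (d i * A zero (punchIn p j)))
            ≈⟨ sum-cong-≋ (λ j → distribˡ (ν j) _ _) ⟨
          sum (λ j → ν j * B i j)
            ≈⟨ νB≈0 i ⟩
          0# ∎
          where
          R : Carrier
          R = sum (λ j → ν j * A (suc i) (punchIn p j))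
          swap : ∀ x y z → x * (y * z) ≈ y * (x * z)
          swap x y z = trans (sym (*-assoc x y z)) (trans (*-congʳ (*-comm x y)) (*-assoc y x z))

    no-pivot : ∀ p → A zero p ≈ 0#
    no-pivot p = proj₁ (tight _ _) λ Ap#0 →
      let u , uAp≈1 = leftInverse Ap#0
          open Pivot p u uAp≈1
      in kernel-nontrivial n<s B λ ν νB≈0 j →
           trans (reflexive (≡.sym (insertAt-punchIn ν p _ j)))
                 (trivial (lift ν νB≈0) (lift-kills ν νB≈0) (punchIn p j))

-- Finite lists and indices.

lookup-injective : ∀ {a} {A : Set a} {xs : List A} → Unique xs →
                   ∀ i j → lookup xs i ≡ lookup xs j → i ≡ j
lookup-injective (_ ∷ _) zero zero _ = ≡.refl
lookup-injective (x∉xs ∷ _) zero (suc j) eq = contradiction eq (All.lookup x∉xs (∈-lookup j))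
lookup-injective (x∉xs ∷ _) (suc i) zero eq =
  contradiction (≡.sym eq) (All.lookup x∉xs (∈-lookup i))
lookup-injective (_ ∷ xs!) (suc i) (suc j) eq = ≡.cong suc (lookup-injective xs! i j eq)

punchIn-covers : ∀ {n} (i k : Fin (suc n)) → i ≡ k ⊎ ∃ λ t → punchIn i t ≡ k
punchIn-covers i k with i ≟ k
... | yes i≡k = inj₁ i≡k
... | no  i≢k = inj₂ (punchOut i≢k , punchIn-punchOut i≢k)

-- Two distinct indices force `m` to be positive, so its predecessor `n` is part of the result. Once
-- `i` is omitted, `j` becomes `punchOut i≢j`, and this is the second index to omit.
omit₂ : ∀ {m} {i j : Fin (suc m)} → i ≢ j →
        ∃ λ n → suc n ≡ m × Σ (Fin n → Fin (suc m)) λ g →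
          ∀ k → i ≡ k ⊎ j ≡ k ⊎ ∃ λ t → g t ≡ k
omit₂ {zero}  {zero} {zero} i≢j = contradiction ≡.refl i≢j
omit₂ {suc n} {i} {j} i≢j =
  n , ≡.refl , punchIn i ∘ punchIn (punchOut i≢j) , covers
  where
  covers : ∀ k → i ≡ k ⊎ j ≡ k ⊎ ∃ λ t → punchIn i (punchIn (punchOut i≢j) t) ≡ k
  covers k with punchIn-covers i k
  ... | inj₁ i≡k = inj₁ i≡k
  ... | inj₂ (t , eq) with punchIn-covers (punchOut i≢j) t
  ...   | inj₁ eq′ = inj₂ (inj₁
            (≡.trans (≡.sym (punchIn-punchOut i≢j)) (≡.trans (≡.cong (punchIn i) eq′) eq)))
  ...   | inj₂ (u , eq′) = inj₂ (inj₂ (u , ≡.trans (≡.cong (punchIn i) eq′) eq))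

-- Enumeration of the arcs.

module ArcEnumeration (G : SimpleGraph) where
  open Digraph G

  adj-irrefl′ : ∀ {i} → ¬ Adj i i
  adj-irrefl′ {i} = ≡.subst T (adj-irrefl i)

  -- Equality would make source and target coincide, and the arc a loop.
  arc-≢-reverse : ∀ a → a ≢ reverse a
  arc-≢-reverse (arc i j ij) eq =
    ⊥-elim-irr (adj-irrefl′ (≡.subst (Adj i) (≡.sym (≡.cong Arc.src eq)) ij))

  _≟ᴬ_ : DecidableEquality Arc
  arc i j _ ≟ᴬ arc i′ j′ _ =
    map′ (λ { (≡.refl , ≡.refl) → ≡.refl })
         (λ eq → ≡.cong Arc.src eq , ≡.cong Arc.tgt eq)
         (i ≟ i′ ×-dec j ≟ j′)

  arcsBetween : Vertex × Vertex → List Arc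
  arcsBetween (i , j) with T? (adj i j)
  ... | yes ij = arc i j ij ∷ []
  ... | no  _  = []

  ∈-arcsBetween : ∀ i j .(ij : Adj i j) → arc i j ij ∈ arcsBetween (i , j)
  ∈-arcsBetween i j ij with T? (adj i j)
  ... | yes _  = here ≡.refl
  ... | no ¬ij = ⊥-elim-irr (¬ij ij)

  arcCandidates : List Arc
  arcCandidates = concatMap arcsBetween (cartesianProduct (allFin order) (allFin order))

  -- Deduplication makes `arcAt` injective, so the candidates only have to be shown to include every
  -- arc.
  arcList : List Arc
  arcList = deduplicate _≟ᴬ_ arcCandidates

  ∈-arcList : ∀ a → a ∈ arcList
  ∈-arcList (arc i j ij) = ∈-deduplicate⁺ _≟ᴬ_ {xs = arcCandidates}
    (∈-concatMap⁺ arcsBetween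
      (lose (∈-cartesianProduct⁺ (∈-allFin i) (∈-allFin j)) (∈-arcsBetween i j ij)))

  arcCount : ℕ
  arcCount = length arcList

  arcAt : Fin arcCount → Arc
  arcAt = lookup arcList

  arcIndex : Arc → Fin arcCount
  arcIndex a = index (∈-arcList a)

  arcAt-arcIndex : ∀ a → arcAt (arcIndex a) ≡ a
  arcAt-arcIndex a = ≡.sym (lookup-index (∈-arcList a))

  arcAt-injective : ∀ i j → arcAt i ≡ arcAt j → i ≡ j
  arcAt-injective = lookup-injective (Unique.deduplicate-! _≟ᴬ_ arcCandidates)

module PolytopeProperties {c ℓ₁ ℓ₂ ℓ₃} (K : OrderedField c ℓ₁ ℓ₂ ℓ₃)
                          (G : SimpleGraph) (κ : ℕ) where
  open OrderedField K hiding (zero; _-_)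
  open OrderedFieldProperties K
  open Polytope K G κ
    hiding (Carrier; _≈_; _≤_; _+_; _-_; _*_; 0#; 1#; sum; fromNat)
  open ArcEnumeration G

  -- Coordinates and affine independence.

  m : ℕ
  m = arcCount

  -- Numbers the `m + 1` coordinates of the ambient space, with `z` first.
  coord : Fin (suc m) → Point → Carrier
  coord zero    = proj₂
  coord (suc i) x = proj₁ x (arcAt i)

  coord-arcIndex : ∀ a x → coord (suc (arcIndex a)) x ≡ proj₁ x a
  coord-arcIndex a x = ≡.cong (proj₁ x) (arcAt-arcIndex a)

  ≋-fromCoords : ∀ {k} (μ : Fin k → Carrier) (p : Fin k → Point) →
                 (∀ i → sum (λ t → μ t * coord i (p t)) ≈ 0#) → combination μ p ≋ origin
  ≋-fromCoords μ p eqs =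
    (λ a → ≡.subst (λ a → sum (λ t → μ t * proj₁ (p t) a) ≈ 0#) (arcAt-arcIndex a)
                   (eqs (suc (arcIndex a)))) ,
    eqs zero

  -- With more than `n + 1` points, the all-ones row and the `n` rows of the coordinates in `g` form
  -- a system with more unknowns than equations. Each of its solutions has total weight zero, so it
  -- also kills every constant coordinate, and independence would make it trivial. The order of the
  -- naturals is decidable, so this refutation suffices.
  affinelyIndependent-bound :
    ∀ {n s} (g : Fin n → Fin (suc m)) (p : Fin s → Point) →
    (∀ k → (∃ λ i → g i ≡ k) ⊎ (∃ λ v → ∀ t → coord k (p t) ≈ v)) →
    AffinelyIndependent p → s ℕ.≤ suc n
  affinelyIndependent-bound {n} {s} g p dependent independent =
    decidable-stable (s ℕ.≤? suc n) λ s≰1+n →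
      kernel-nontrivial (ℕ.≰⇒> s≰1+n) rows λ μ kills →
        let sum≈0 : sum μ ≈ 0#
            sum≈0 = trans (sum-cong-≋ λ t → sym (*-identityʳ (μ t))) (kills zero)
            coords≈0 : ∀ k → sum (λ t → μ t * coord k (p t)) ≈ 0#
            coords≈0 k = [ (λ { (i , ≡.refl) → kills (suc i) })
                         , (λ { (v , const) → trans (sum-weighted-const μ const)
                                                    (trans (*-congʳ sum≈0) (zeroˡ v)) })
                         ]′ (dependent k)
        in independent μ sum≈0 (≋-fromCoords μ p coords≈0)
    where
    rows : Fin (suc n) → Fin s → Carrier
    rows zero    t = 1#
    rows (suc i) t = coord (g i) (p t)

  -- An affine relation among the remaining points extends to all of them with coefficient zero at
  -- `i`.
  affinelyIndependent-removeAt :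
    ∀ {n} {p : Fin (suc n) → Point} → AffinelyIndependent p →
    ∀ i → AffinelyIndependent (p ∘ punchIn i)
  affinelyIndependent-removeAt {n} {p} independent i ν sum≈0 (arcs≈0 , z≈0) j =
    trans (reflexive (≡.sym (insertAt-punchIn ν i 0# j)))
          (independent μ sumμ≈0
            ((λ a → extended (λ t → proj₁ (p t) a) (arcs≈0 a)) , extended (proj₂ ∘ p) z≈0)
            (punchIn i j))
    where
    μ : Fin (suc n) → Carrier
    μ = insertAt ν i 0#
    extended : ∀ (f : Fin (suc n) → Carrier) → sum (λ j → ν j * f (punchIn i j)) ≈ 0# →
               sum (λ t → μ t * f t) ≈ 0#
    extended f eq = trans (sum-insertAt ν i 0# f)
      (trans (+-cong (zeroˡ (f i)) eq) (+-identityˡ 0#))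
    sumμ≈0 : sum μ ≈ 0#
    -- The total weight is treated as the weighted sum of the constant function `1#`.
    sumμ≈0 = trans (sum-cong-≋ λ t → sym (*-identityʳ (μ t)))
      (extended (λ _ → 1#) (trans (sum-cong-≋ λ j → *-identityʳ (ν j)) sum≈0))

  -- The base points: affine independence and feasibility.

  indicator : Arc → Arc → Carrier
  indicator b a = if does (b ≟ᴬ a) then 1# else 0#

  indicator-≡ : ∀ {a b} → b ≡ a → indicator b a ≈ 1#
  indicator-≡ {a} {b} b≡a = reflexive
    (≡.cong (λ d → if d then 1# else 0#) (dec-true (b ≟ᴬ a) b≡a))

  indicator-≢ : ∀ {a b} → b ≢ a → indicator b a ≈ 0#
  indicator-≢ {a} {b} b≢a = reflexive
    (≡.cong (λ d → if d then 1# else 0#) (dec-false (b ≟ᴬ a) b≢a))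

  basePoint : Fin (suc (suc m)) → Point
  basePoint zero          = origin
  basePoint (suc zero)    = (λ _ → 0#) , fromNat κ
  basePoint (suc (suc i)) = indicator (arcAt i) , fromNat κ

  -- The coefficients vanish from the last to the first: the coordinate of each arc isolates the
  -- coefficient of its unit vector, then `z` leaves only that of the second point times the nonzero
  -- number κ, and the total weight leaves that of the origin.
  basePoint-affinelyIndependent : .{{_ : NonZero κ}} → AffinelyIndependent basePoint
  basePoint-affinelyIndependent μ sum≈0 (arcs≈0 , z≈0) = λ where
      zero          → μ₀≈0
      (suc zero)    → μ₁≈0
      (suc (suc i)) → μ₂₊≈0 i
    where
    drop₂ : ∀ {x y z} → x ≈ 0# → y ≈ 0# → x + (y + z) ≈ z
    drop₂ x≈0 y≈0 = trans (+-cong x≈0 (+-congʳ y≈0)) (trans (+-identityˡ _) (+-identityˡ _))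

    drop₁₃ : ∀ {x y z} → x ≈ 0# → z ≈ 0# → x + (y + z) ≈ y
    drop₁₃ x≈0 z≈0 = trans (+-cong x≈0 (+-congˡ z≈0)) (trans (+-identityˡ _) (+-identityʳ _))

    μ₂₊≈0 : ∀ i → μ (suc (suc i)) ≈ 0#
    μ₂₊≈0 i = begin
      μ (suc (suc i))
        ≈⟨ *-identityʳ _ ⟨
      μ (suc (suc i)) * 1#
        ≈⟨ *-congˡ (indicator-≡ {arcAt i} ≡.refl) ⟨
      μ (suc (suc i)) * indicator (arcAt i) (arcAt i)
        ≈⟨ sum-single (λ j → μ (suc (suc j)) * indicator (arcAt j) (arcAt i)) i (λ j j≢i →
             trans (*-congˡ (indicator-≢ (j≢i ∘ arcAt-injective j i))) (zeroʳ _)) ⟨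
      sum (λ j → μ (suc (suc j)) * indicator (arcAt j) (arcAt i))
        ≈⟨ drop₂ (zeroʳ _) (zeroʳ _) ⟨
      proj₁ (combination μ basePoint) (arcAt i)
        ≈⟨ arcs≈0 (arcAt i) ⟩
      0# ∎

    μ₁≈0 : μ (suc zero) ≈ 0#
    μ₁≈0 = *-zero-cancelʳ (fromNat#0 κ) (trans
      (sym (drop₁₃ (zeroʳ _) (sum-zero λ j → trans (*-congʳ (μ₂₊≈0 j)) (zeroˡ _))))
      z≈0)

    μ₀≈0 : μ zero ≈ 0#
    μ₀≈0 = trans (sym (+-identityʳ _)) (trans
      (+-congˡ (sym (sum-zero {f = μ ∘ suc} λ { zero → μ₁≈0 ; (suc j) → μ₂₊≈0 j })))
      sum≈0)

  ≤1-if-binary : ∀ {x} → x ≈ 0# ⊎ x ≈ 1# → x ≤ 1#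
  ≤1-if-binary = [ (λ x≈0 → ≤-resp-≈ (sym x≈0) refl 0≤1) , ≤-reflexive ]′

  0≤-if-binary : ∀ {x} → x ≈ 0# ⊎ x ≈ 1# → 0# ≤ x
  0≤-if-binary = [ ≤-reflexive ∘ sym , (λ x≈1 → ≤-resp-≈ refl (sym x≈1) 0≤1) ]′

  -- The first and the closing arc are distinct, so together they weigh at most 1.
  cycle-bound : ∀ {w : Arc → Carrier} → (∀ a → w a ≤ 1#) →
                (∀ {a b} → a ≢ b → w a + w b ≤ 1#) →
                ∀ (C : Cycle) →
                sum (λ t → w (Cycle.arcs C t)) + w (Cycle.closingArc C)
                  ≤ fromNat (Cycle.length C) + - 1#
  cycle-bound w≤1 w₂≤1 record { pathLength = zero ; closing = loop } =
    ⊥-elim (adj-irrefl′ loop)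
  cycle-bound {w} w≤1 w₂≤1 C@record { pathLength = suc k } =
    ≤-resp-≈ regroup (sym (trans (+-congʳ (+-comm 1# _)) (x+y-y≈x _ 1#)))
      (+-mono-≤ (w₂≤1 first≢closing) (sum-≤-fromNat λ t → w≤1 (arcs (suc t))))
    where
    open Cycle C using (path; arcs; closingArc)
    rest : Carrier
    rest = sum (λ t → w (arcs (suc t)))
    first≢closing : arcs zero ≢ closingArc
    first≢closing eq with Path.elementary path (≡.cong Arc.src eq)
    ... | ()
    regroup : w (arcs zero) + w closingArc + rest ≈ w (arcs zero) + rest + w closingArc
    regroup = trans (+-assoc _ _ _) (trans (+-congˡ (+-comm _ _)) (sym (+-assoc _ _ _)))

  -- The bound on pairs of distinct arcs covers two constraints at once: an arc differs from its
  -- reverse, and every cycle contains two distinct arcs.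
  feasible : ∀ {w z} → (∀ a → w a ≈ 0# ⊎ w a ≈ 1#) →
             (∀ {a b} → a ≢ b → w a + w b ≤ 1#) →
             (∀ (p : Path κ) → sum (λ t → w (Path.arcs p t)) ≤ z) →
             0# ≤ z → z ≤ fromNat κ → Feasible (w , z)
  feasible binary w₂≤1 path 0≤z z≤κ = record
    { edge   = λ a → w₂≤1 (arc-≢-reverse a)
    ; cycle  = cycle-bound (≤1-if-binary ∘ binary) w₂≤1
    ; path   = path
    ; binary = binary
    ; z≥0    = 0≤z
    ; z≤κ    = z≤κ
    }

  0+0≤1 : 0# + 0# ≤ 1#
  0+0≤1 = ≤-resp-≈ (sym (+-identityˡ 0#)) refl 0≤1

  basePoint-feasible : ∀ t → Feasible (basePoint t)
  basePoint-feasible zero = feasible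
    (λ _ → inj₁ refl) (λ _ → 0+0≤1)
    (λ p → ≤-reflexive (sum-zero {κ} λ _ → refl))
    (≤-reflexive refl) (0≤fromNat κ)
  basePoint-feasible (suc zero) = feasible
    (λ _ → inj₁ refl) (λ _ → 0+0≤1)
    (λ p → ≤-resp-≈ (sym (sum-zero {κ} λ _ → refl)) refl (0≤fromNat κ))
    (0≤fromNat κ) (≤-reflexive refl)
  basePoint-feasible (suc (suc i)) = feasible
    binary atMostOne
    -- With `z` equal to κ, each of the κ arcs of the path may weigh up to 1.
    (λ p → sum-≤-fromNat λ t → ≤1-if-binary (binary (Path.arcs p t)))
    (0≤fromNat κ) (≤-reflexive refl)
    where
    e : Arc → Carrier
    e = indicator (arcAt i)
    binary : ∀ a → e a ≈ 0# ⊎ e a ≈ 1#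
    binary a with arcAt i ≟ᴬ a
    ... | yes i≡a = inj₂ (indicator-≡ i≡a)
    ... | no  i≢a = inj₁ (indicator-≢ i≢a)
    atMostOne : ∀ {a b} → a ≢ b → e a + e b ≤ 1#
    atMostOne {a} {b} a≢b with arcAt i ≟ᴬ a | arcAt i ≟ᴬ b
    ... | yes i≡a | yes i≡b = contradiction (≡.trans (≡.sym i≡a) i≡b) a≢b
    ... | yes i≡a | no  i≢b = ≤-reflexive
      (trans (+-cong (indicator-≡ i≡a) (indicator-≢ i≢b)) (+-identityʳ 1#))
    ... | no  i≢a | _       = ≤-resp-≈
      (sym (trans (+-congʳ (indicator-≢ i≢a)) (+-identityˡ (e b)))) refl
      (≤1-if-binary (binary b))

  -- Passing from feasible points to the convex hull.

  Feasible⇒P : ∀ {x} → Feasible x → P x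
  Feasible⇒P {x} fx = 1 , (λ _ → 1#) , (λ _ → x) , (λ _ → fx) , (λ _ → 0≤1) ,
    +-identityʳ 1# , (λ a → single _) , single _
    where
    single : ∀ y → y ≈ 1# * y + 0#
    single y = sym (trans (+-identityʳ _) (*-identityˡ y))

  -- Compatibility with combinations of total weight 1, stated up to `≋` so that it applies directly
  -- to a witness of membership in the hull.
  Affine : (Point → Carrier) → Set (c Level.⊔ ℓ₁)
  Affine f = ∀ {k x} (μ : Fin k → Carrier) (p : Fin k → Point) →
             sum μ ≈ 1# → x ≋ combination μ p → f x ≈ sum (λ t → μ t * f (p t))

  affine-const : ∀ v → Affine (λ _ → v)
  affine-const v μ p sum≈1 _ = sym (trans (sum-weighted-const μ {λ _ → v} (λ _ → refl))
    (trans (*-congʳ sum≈1) (*-identityˡ v)))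

  affine-arc : ∀ a → Affine (λ x → proj₁ x a)
  affine-arc a μ p _ (arcs≈ , _) = arcs≈ a

  affine-z : Affine proj₂
  affine-z μ p _ (_ , z≈) = z≈

  affine-+ : ∀ {f g} → Affine f → Affine g → Affine (λ x → f x + g x)
  affine-+ {f} {g} affine-f affine-g μ p sum≈1 x≋ = trans
    (+-cong (affine-f μ p sum≈1 x≋) (affine-g μ p sum≈1 x≋))
    (trans (sym (∑-distrib-+ (λ t → μ t * f (p t)) (λ t → μ t * g (p t))))
           (sum-cong-≋ λ t → sym (distribˡ (μ t) (f (p t)) (g (p t)))))

  -- Both sides expand into weighted sums over feasible points, which compare term by term because
  -- the weights are nonnegative.
  valid-on-P : ∀ {f g} → Affine f → Affine g →
               (∀ x → Feasible x → f x ≤ g x) → ∀ x → P x → f x ≤ g x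
  valid-on-P affine-f affine-g f≤g x (k , μ , p , fp , 0≤μ , sum≈1 , x≋) =
    ≤-resp-≈ (sym (affine-f μ p sum≈1 x≋)) (sym (affine-g μ p sum≈1 x≋))
      (sum-mono-≤ λ t → *-monoˡ-≤ (0≤μ t) (f≤g (p t) (fp t)))

  -- Criteria for being and for not being a facet.

  -- Coordinate `i` is constant on the face, which leaves `m` free coordinates and so at most
  -- `m + 1` independent points. The base points other than the one at `k` attain this bound, one
  -- less than the `m + 2` points for the whole polytope.
  facet : ∀ {lhs rhs} .{{_ : NonZero κ}} → (∀ x → P x → lhs x ≤ rhs x) →
          ∀ i v → (∀ x → lhs x ≈ rhs x → coord i x ≈ v) →
          ∀ k → (∀ t → lhs (basePoint (punchIn k t)) ≈ rhs (basePoint (punchIn k t))) →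
          DefinesFacet lhs rhs
  facet valid i v coord≈v k tight = record
    { valid       = valid
    ; codimension = + suc (suc m) ℤ.- + 1
      , (suc (suc m) , ≡.refl
        , (basePoint , Feasible⇒P ∘ basePoint-feasible , basePoint-affinelyIndependent)
        , λ p _ → affinelyIndependent-bound id p (λ k → inj₁ (k , ≡.refl)))
      , (suc m , ≡.refl
        , (basePoint ∘ punchIn k
          , (λ t → Feasible⇒P (basePoint-feasible (punchIn k t)) , tight t)
          , affinelyIndependent-removeAt {p = basePoint} basePoint-affinelyIndependent k)
        , λ p p∈ → affinelyIndependent-bound (punchIn i) p λ j →
            [ (λ { ≡.refl → inj₂ (v , λ t → coord≈v (p t) (proj₂ (p∈ t))) }) , inj₁ ]′
              (punchIn-covers i j))
    }

  -- The base points make the maximum `r` for the polytope at least `m + 2`, so a facet would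
  -- contain `r′ = r - 1`, hence at least `m + 1`, independent points. Two constant coordinates
  -- leave `m - 1` free ones and allow only `m`.
  ¬facet : ∀ {lhs rhs} .{{_ : NonZero κ}} → ∀ i j → i ≢ j →
           ∀ u v → (∀ x → P x → lhs x ≈ rhs x → coord i x ≈ u × coord j x ≈ v) →
           ¬ DefinesFacet lhs rhs
  ¬facet i j i≢j u v const F with omit₂ i≢j | DefinesFacet.codimension F
  ... | n , 1+n≡m , g , covers
      | d , (r , d≡r-1 , _ , max) , (r′ , d-1≡r′-1 , (p , p∈ , independent) , _) =
    ℕ.<-irrefl ≡.refl (ℕ.≤-trans m<r′ r′≤m)
    where
    r≡1+r′ : r ≡ suc r′
    -- The inner cancellation yields `r - 1 = r′`; the outer one reads the right side as
    -- `suc r′ - 1`.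
    r≡1+r′ = ℤ.+-injective (ℤ-+-cancelʳ (ℤ.- + 1) (+ r) (+ suc r′)
      (ℤ-+-cancelʳ (ℤ.- + 1) (+ r ℤ.- + 1) (+ r′)
        (≡.trans (≡.cong (ℤ._- + 1) (≡.sym d≡r-1)) d-1≡r′-1)))
    m<r′ : m ℕ.< r′
    m<r′ = ℕ.s≤s⁻¹ (≡.subst (suc (suc m) ℕ.≤_) r≡1+r′
      (max basePoint (Feasible⇒P ∘ basePoint-feasible) basePoint-affinelyIndependent))
    r′≤m : r′ ℕ.≤ m
    r′≤m = ≡.subst (r′ ℕ.≤_) 1+n≡m (affinelyIndependent-bound g p dependent independent)
      where
      const-at : ∀ t → coord i (p t) ≈ u × coord j (p t) ≈ v
      const-at t = const (p t) (proj₁ (p∈ t)) (proj₂ (p∈ t))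
      dependent : ∀ k → (∃ λ t → g t ≡ k) ⊎ (∃ λ v → ∀ t → coord k (p t) ≈ v)
      dependent k with covers k
      ... | inj₁ ≡.refl        = inj₂ (u , proj₁ ∘ const-at)
      ... | inj₂ (inj₁ ≡.refl) = inj₂ (v , proj₂ ∘ const-at)
      ... | inj₂ (inj₂ hit)    = inj₁ hit

  -- The four inequalities.

  sum-≥-term : ∀ {n} {f : Fin n → Carrier} → (∀ t → 0# ≤ f t) → ∀ i → f i ≤ sum f
  sum-≥-term {suc n} {f} 0≤f i = ≤-resp-≈ (+-identityʳ (f i)) (sym (sum-remove {i = i} f))
    (+-mono-≤ (≤-reflexive refl)
      (≤-resp-≈ (sum-zero {n} λ _ → refl) refl (sum-mono-≤ λ j → 0≤f (punchIn i j))))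

  valid-arc≥0 : ∀ a x → P x → 0# ≤ proj₁ x a
  valid-arc≥0 a = valid-on-P (affine-const 0#) (affine-arc a) λ x fx →
    0≤-if-binary (Feasible.binary fx a)

  valid-edge : ∀ a x → P x → proj₁ x a + proj₁ x (reverse a) ≤ 1#
  valid-edge a = valid-on-P (affine-+ (affine-arc a) (affine-arc (reverse a)))
    (affine-const 1#) λ x fx → Feasible.edge fx a

  -- Weights are nonnegative at feasible points, so one arc weighs no more than its path, which (3)
  -- bounds by `z`.
  valid-path-arc : ∀ (p : Path κ) t x → P x → proj₁ x (Path.arcs p t) ≤ proj₂ x
  valid-path-arc p t = valid-on-P (affine-arc (Path.arcs p t)) affine-z λ x fx →
    ≤-trans (sum-≥-term (λ t → 0≤-if-binary (Feasible.binary fx (Path.arcs p t))) t)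
            (Feasible.path fx p)

  valid-z≤κ : ∀ x → P x → proj₂ x ≤ fromNat κ
  valid-z≤κ = valid-on-P affine-z (affine-const (fromNat κ)) λ x → Feasible.z≤κ

  arc≥0-facet : .{{_ : NonZero κ}} → ∀ a → DefinesFacet (λ _ → 0#) (λ x → proj₁ x a)
  arc≥0-facet a = facet (valid-arc≥0 a) (suc (arcIndex a)) 0#
    (λ x 0≈ → trans (reflexive (coord-arcIndex a x)) (sym 0≈))
    k (λ t → vanishes (punchIn k t) (punchInᵢ≢i k t))
    where
    k : Fin (suc (suc m))
    -- The unit vector of `a` is the one base point off the face; the shift by two skips the points
    -- with zero arc part.
    k = suc (suc (arcIndex a))
    vanishes : ∀ t → t ≢ k → 0# ≈ proj₁ (basePoint t) a
    vanishes zero          t≢k = refl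
    vanishes (suc zero)    t≢k = refl
    vanishes (suc (suc i)) t≢k = sym (indicator-≢ λ i≡a → t≢k (≡.cong (λ j → suc (suc j))
      (arcAt-injective _ _ (≡.trans i≡a (≡.sym (arcAt-arcIndex a))))))

  arc≤1-¬facet : .{{_ : NonZero κ}} → ∀ a → ¬ DefinesFacet (λ x → proj₁ x a) (λ _ → 1#)
  arc≤1-¬facet a = ¬facet (suc (arcIndex a)) (suc (arcIndex (reverse a))) distinct
    1# 0# λ x x∈P wₐ≈1 →
      trans (reflexive (coord-arcIndex a x)) wₐ≈1 ,
      trans (reflexive (coord-arcIndex (reverse a) x))
            (≤-antisym (reverse≤0 x x∈P wₐ≈1) (valid-arc≥0 (reverse a) x x∈P))
    where
    distinct : suc (arcIndex a) ≢ suc (arcIndex (reverse a))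
    distinct eq = arc-≢-reverse a (≡.trans (≡.sym (arcAt-arcIndex a))
      (≡.trans (≡.cong arcAt (suc-injective eq)) (arcAt-arcIndex (reverse a))))
    reverse≤0 : ∀ x → P x → proj₁ x a ≈ 1# → proj₁ x (reverse a) ≤ 0#
    reverse≤0 x x∈P wₐ≈1 0<w = valid-edge a x x∈P
      (<-respˡ-≈ (+-identityˡ 1#) (<-respʳ-≈
        (trans (+-comm _ _) (+-congʳ (sym wₐ≈1))) (+-monoˡ-< 1# 0<w)))

  -- The path supplies the second constant coordinate. Without any path of κ arcs, the points with
  -- `z = 0` whose arc part is zero or a unit vector are feasible, and `z ≥ 0` does define a facet.
  z≥0-¬facet : .{{_ : NonZero κ}} → Path κ → ¬ DefinesFacet (λ _ → 0#) proj₂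
  z≥0-¬facet p = ¬facet zero (suc (arcIndex a)) (λ ()) 0# 0# λ x x∈P 0≈z →
    sym 0≈z ,
    trans (reflexive (coord-arcIndex a x))
          (≤-antisym (≤-resp-≈ refl (sym 0≈z) (valid-path-arc p first x x∈P))
                     (valid-arc≥0 a x x∈P))
    where
    first : Fin κ
    -- Positivity of κ ensures that the path has an arc.
    first = fromℕ< (ℕ.>-nonZero⁻¹ κ)
    a : Arc
    a = Path.arcs p first

  z≤κ-facet : .{{_ : NonZero κ}} → DefinesFacet proj₂ (λ _ → fromNat κ)
  -- The final `zero` omits the origin, the only base point with `z` different from κ.
  z≤κ-facet = facet valid-z≤κ zero (fromNat κ) (λ x z≈κ → z≈κ) zero
    λ { zero → refl ; (suc t) → refl }

theorem4 : ∀ {c ℓ₁ ℓ₂ ℓ₃} (K : OrderedField c ℓ₁ ℓ₂ ℓ₃)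
    (G : SimpleGraph) (κ : ℕ) .{{_ : NonZero κ}} →
    let open Polytope K G κ in
    (∀ (a : Arc) → DefinesFacet (λ x → 0#) (λ x → proj₁ x a))
    × (∀ (a : Arc) → ¬ DefinesFacet (λ x → proj₁ x a) (λ x → 1#))
    × (Path κ → ¬ DefinesFacet (λ x → 0#) (λ x → proj₂ x))
    × DefinesFacet (λ x → proj₂ x) (λ x → fromNat κ)
theorem4 K G κ = arc≥0-facet , arc≤1-¬facet , z≥0-¬facet , z≤κ-facet
  where open PolytopeProperties K G κ
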